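{- Let $\kappa$ be an infinite cardinal, and let $\mathcal{L}\subsetneq\mathrm{Lin}_\kappa$ be nonempty and downward $\preceq$-closed and such that $\trianglelefteq^{\mathcal{L}}_\kappa$ is transitive. Then the quasi-order $\trianglelefteq^{\mathcal{L}}_\kappa$ has no maximal element, and every dominating family with respect to $\trianglelefteq^{\mathcal{L}}_\kappa$ has size $2^\kappa$. Hence $\mathfrak{d}(\trianglelefteq^{\mathcal{L}}_\kappa)=2^\kappa$.
   Context: Linear orders are reflexive and nonempty; $L\preceq L'$ means there is an embedding $f:L\to L'$, i.e. $x\le_L y\iff f(x)\le_{L'}f(y)$. For a cardinal $\kappa$, $\mathrm{LO}_\kappa$ is the set of (codes for) linear orders with domain $\kappa$, and $\mathrm{Lin}_\kappa=\bigcup_{0<\lambda\le\kappa}\mathrm{LO}_\lambda$ ($\lambda$ ranging over cardinals), i.e. the nonempty linear orders of size at most $\kappa$. $\mathcal{L}\subseteq\mathrm{Lin}_\kappa$ is downward $\preceq$-closed if $K\in\mathrm{Lin}_\kappa$, $K\preceq L\in\mathcal{L}$ imply $K\in\mathcal{L}$; membership is meant up to isomorphism. A subset $I$ of $L$ is convex if $x\le_L y\le_L z$ and $x,z\in I$ imply $y\in I$. A $K$-convex partition of $L$ is a partition $(L_k)_{k\in K}$ of $L$ (into nonempty sets) such that $k<_K k'\iff$ every element of $L_k$ is $<_L$ every element of $L_{k'}$. $L\trianglelefteq^{\mathcal{L}}L'$ iff there are $K\in\mathcal{L}$, a $K$-convex partition $(L_k)_{k\in K}$ of $L$, and an embedding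 $f$ of $L$ into $L'$ such that each $f(L_k)$ is a convex subset of $L'$. $\trianglelefteq^{\mathcal{L}}_\kappa$ is the restriction of $\trianglelefteq^{\mathcal{L}}$ to $\mathrm{LO}_\kappa$. For a quasi-order $\precsim$ on $X$: $x$ is maximal if there is no $y\in X$ with $x\precsim y$ and $y\not\precsim x$; $\mathcal{F}\subseteq X$ is a dominating family if for every $x\in X$ there is $y\in\mathcal{F}$ with $x\precsim y$; $\mathfrak{d}(\precsim)$ is the least size of a dominating family. -}

module Defs where

open import Axiom.ExcludedMiddle using (ExcludedMiddle)
open import Axiom.Extensionality.Propositional using (Extensionality)
open import Data.Bool.Base using (Bool)
open import Data.Nat.Base using (ℕ)
open import Data.Product.Base using (Σ; ∃; ∃-syntax; _×_; proj₁)
open import Function.Bundles using (_⇔_; _↣_; Injection; Bijection)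
open import Function.Definitions using (Injective)
open import Induction.WellFounded using (WellFounded)
open import Level using (Setω; 0ℓ; suc)
open import Relation.Binary.Bundles using (Setoid)
open import Relation.Binary.Core using (Rel)
import Relation.Binary.Construct.NonStrictToStrict as ToStrict
import Relation.Binary.Construct.On as On
open import Relation.Binary.PropositionalEquality using (_≡_; _→-setoid_)
open import Relation.Binary.Structures using (IsTotalOrder; IsStrictTotalOrder)
open import Relation.Nullary using (¬_)
open import Relation.Unary using (Pred; _∈_)

-- The ambient classical set theory.  Excluded middle is about arbitrary types,
-- not just propositions, so it yields the axiom of choice: it turns ¬ ¬ P x
-- into P x.  Function extensionality makes the resulting choice functions
-- respect extensional equality, e.g. on K → Bool.
record Classical : Setω where
  field
    excludedMiddle : ∀ {ℓ} → ExcludedMiddle ℓ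
    extensionality : ∀ {a b} → Extensionality a b

------------------------------------------------------------------------
-- Cardinals

-- An infinite initial ordinal, given as a well-ordered set: it is not
-- equinumerous with any of its proper initial segments.
record InfiniteCardinal : Set₁ where
  infix 4 _<_
  field
    Carrier            : Set
    _<_                : Rel Carrier 0ℓ
    isStrictTotalOrder : IsStrictTotalOrder _≡_ _<_
    wellFounded        : WellFounded _<_
    initial            : ∀ a → ¬ (Σ (Carrier → Carrier) λ f →
                           Injective _≡_ _≡_ f ×
                           (∀ y → (y < a) ⇔ (∃[ x ] f x ≡ y)))
    infinite           : ℕ ↣ Carrier

∥_∥ : InfiniteCardinal → Set
∥ κ ∥ = InfiniteCardinal.Carrier κ

2^_ : InfiniteCardinal → Setoid 0ℓ 0ℓ
2^ κ = ∥ κ ∥ →-setoid Bool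

------------------------------------------------------------------------
-- Linear orders

record LinearOrder (A : Set) : Set₁ where
  infix 4 _≤_
  field
    _≤_          : Rel A 0ℓ
    isTotalOrder : IsTotalOrder _≡_ _≤_

  open ToStrict _≡_ _≤_ public using (_<_)

private
  variable
    A B : Set

IsEmbedding : LinearOrder A → LinearOrder B → (A → B) → Set
IsEmbedding L L′ f = ∀ x y → (x L.≤ y) ⇔ (f x L′.≤ f y)
  where
  module L  = LinearOrder L
  module L′ = LinearOrder L′

infix 4 _⪯_

_⪯_ : LinearOrder A → LinearOrder B → Set
L ⪯ L′ = ∃ λ f → IsEmbedding L L′ f

-- Two orders on A are equal when they are the same relation.
LO : Set → Setoid (suc 0ℓ) 0ℓ
LO A = record
  { Carrier       = LinearOrder A
  ; _≈_           = λ L L′ → ∀ x y →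
                      LinearOrder._≤_ L x y ⇔ LinearOrder._≤_ L′ x y
  ; isEquivalence = record
    { refl  = λ x y → ⇔.refl
    ; sym   = λ p x y → ⇔.sym (p x y)
    ; trans = λ p q x y → ⇔.trans (p x y) (q x y)
    }
  }
  where
  open import Function.Properties.Equivalence using (⇔-isEquivalence)
  open import Relation.Binary.Structures using (IsEquivalence)
  module ⇔ = IsEquivalence (⇔-isEquivalence {0ℓ})

-- The nonempty linear orders of size at most κ, on arbitrary underlying sets;
-- a ⪯-closed class of these is automatically closed under isomorphism.
record Lin (κ : InfiniteCardinal) : Set₁ where
  field
    {Carrier} : Set
    order     : LinearOrder Carrier
    nonempty  : Carrier
    small     : Carrier ↣ ∥ κ ∥

DownwardClosed : ∀ {κ} → Pred (Lin κ) (suc 0ℓ) → Set₁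
DownwardClosed {κ} 𝓛 = (K L : Lin κ) → Lin.order K ⪯ Lin.order L → L ∈ 𝓛 → K ∈ 𝓛

------------------------------------------------------------------------
-- Convexity

IsConvex : LinearOrder A → Pred A 0ℓ → Set
IsConvex L I = ∀ x y z → x ≤ y → y ≤ z → x ∈ I → z ∈ I → y ∈ I
  where open LinearOrder L

Image : (A → B) → Pred A 0ℓ → Pred B 0ℓ
Image f I y = ∃[ x ] x ∈ I × f x ≡ y

record IsConvexPartition (K : LinearOrder A) (L : LinearOrder B)
                         (part : A → Pred B 0ℓ) : Set where
  private
    module K = LinearOrder K
    module L = LinearOrder L
  field
    nonempty : ∀ k → ∃[ x ] x ∈ part k
    disjoint : ∀ k k′ x → x ∈ part k → x ∈ part k′ → k ≡ k′
    covers   : ∀ x → ∃[ k ] x ∈ part k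
    ordered  : ∀ k k′ → (k K.< k′) ⇔
                 (∀ x y → x ∈ part k → y ∈ part k′ → x L.< y)

infix 4 _⊴[_]_

_⊴[_]_ : ∀ {κ} → LinearOrder A → Pred (Lin κ) (suc 0ℓ) → LinearOrder B → Set₁
_⊴[_]_ {A} {B} {κ} L 𝓛 L′ =
  Σ (Lin κ) λ K → K ∈ 𝓛 ×
  Σ (Lin.Carrier K → Pred A 0ℓ) λ part → IsConvexPartition (Lin.order K) L part ×
  Σ (A → B) λ f → IsEmbedding L L′ f ×
  (∀ k → IsConvex L′ (Image f (part k)))

⊴-on-LO : (κ : InfiniteCardinal) → Pred (Lin κ) (suc 0ℓ) →
          Rel (LinearOrder ∥ κ ∥) (suc 0ℓ)
⊴-on-LO κ 𝓛 L L′ = L ⊴[ 𝓛 ] L′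

------------------------------------------------------------------------
-- Maximal elements and dominating families

IsMaximal : {X : Set₁} → Rel X (suc 0ℓ) → X → Set₁
IsMaximal _≾_ x = ¬ (∃[ y ] x ≾ y × ¬ (y ≾ x))

IsDominating : {X : Set₁} → Rel X (suc 0ℓ) → Pred X (suc 0ℓ) → Set₁
IsDominating _≾_ F = ∀ x → ∃[ y ] y ∈ F × x ≾ y

-- The members of F, up to the equality of X.
Members : (X : Setoid (suc 0ℓ) 0ℓ) → Pred (Setoid.Carrier X) (suc 0ℓ) →
          Setoid (suc 0ℓ) 0ℓ
Members X F = On.setoid {B = ∃ F} X proj₁

HasSize : (X : Setoid (suc 0ℓ) 0ℓ) → Pred (Setoid.Carrier X) (suc 0ℓ) →
          Setoid 0ℓ 0ℓ → Set₁
HasSize X F C = Bijection C (Members X F)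

-- 𝔡(≾) = |C|: the least size of a dominating family is that of C.
𝔡[_,_]≡_ : (X : Setoid (suc 0ℓ) 0ℓ) → Rel (Setoid.Carrier X) (suc 0ℓ) →
           Setoid 0ℓ 0ℓ → Set₂
𝔡[ X , _≾_ ]≡ C =
  (∃[ F ] IsDominating _≾_ F × HasSize X F C) ×
  (∀ F → IsDominating _≾_ F → Injection C (Members X F))

{-# OPTIONS --safe #-}
module Submission where

-- Fix an order K₀ ∉ 𝓛 of size at most κ.  Every S ⊆ κ is coded by a linear
-- order `code S` with two properties.
--
-- (1) A point n of an order N determines S, if `code S` embeds in N with
--     convex image and least point n (`decode-unique`).  So N contains convex
--     copies of at most κ many codes.
-- (2) Every L on κ is a convex part of an order `extend L S` on κ such that
--     extend L S ⊴ N puts a convex copy of `code S` into N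
--     (`extend-⊴⇒⊑`).
--
-- `code S` is the sum over α < κ of blocks: ω if α ∈ S and -∞ + ℤ otherwise.
-- The least points of the blocks are exactly the points without immediate
-- predecessor, and such a point has an immediate successor if and only if
-- α ∈ S.  Embeddings with convex image preserve and reflect the relation of
-- being immediate neighbours, so two codes that start at the same point of N
-- agree block by block, by induction on α.
--
-- `extend L S` is L followed by a K₀-sum of copies of `code S`.  Given a
-- partition witnessing extend L S ⊴ N, with index order K ∈ 𝓛, some copy of
-- `code S` lies within a single part, and is then mapped onto a convex set.
-- Otherwise every copy meets two parts, and sending a copy to the upper one of
-- these embeds K₀ in K, so that K₀ ∈ 𝓛 (`copies⇒⊑`).
--
-- Now let F be a set of orders on κ containing, for every S, an order with a
-- convex copy of `code S`; a dominating family is one, by (2).  Regard subsets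
-- of κ as sequences (Sₙ), n ∈ κ, of subsets.  For some n every P ⊆ κ is Sₙ for
-- an S that a member of F determines at n: otherwise choose a counterexample
-- Pₙ for each n, and the code of the sequence (Pₙ) starts at some point n of a
-- member of F, a contradiction (`König`).  Choosing such members gives an
-- injection of the power set of κ into F, by (1).  With F = {L} this is
-- absurd, so some `code S` has no convex copy in L, and extend L S ⋬ L: no L is
-- maximal.  The converse bound on the size of F holds since an order on κ is a
-- subset of κ × κ.
--
-- The cardinal arithmetic used is the Cantor-Schröder-Bernstein theorem and
-- κ × κ ≈ κ.  The latter holds for all infinite well-ordered sets; `square-step`
-- is the inductive step.

open import Defs
open import Data.Bool.Base using (Bool; true; false)
open import Data.Integer.Base as ℤ using (ℤ)
import Data.Integer.Properties as ℤ
open import Data.Nat.Base as ℕ using (ℕ; zero)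
open import Data.Nat.Induction using (<-wellFounded)
import Data.Nat.Properties as ℕ
open import Data.Product.Base using (_×_; Σ; ∃; ∃-syntax; _,_; proj₁; proj₂; map₂)
open import Data.Product.Properties using (,-injectiveˡ; ,-injectiveʳ)
import Data.Product.Relation.Binary.Lex.Strict as Lex
open import Data.Sum.Base using (_⊎_; inj₁; inj₂)
open import Data.Sum.Properties using (inj₁-injective; inj₂-injective)
import Data.Sum.Relation.Binary.LeftOrder as LeftOrder
open LeftOrder using (_⊎-<_)
open import Data.Sum.Relation.Binary.Pointwise using (Pointwise-≡⇒≡)
open import Data.Unit.Base using (⊤; tt)
open import Function.Base using (_∘_; id; case_of_)
open import Function.Bundles
  using (_⇔_; _↣_; _↔_; Injection; Bijection; Inverse; Equivalence; mk⇔; mk↣)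
open import Function.Properties.Bijection using (⤖⇒↔)
open import Function.Properties.Inverse using (↔⇒↣)
open import Induction.WellFounded as WF using (WellFounded; WfRec)
open import Level using (Level; 0ℓ; suc; _⊔_)
open import Relation.Binary.Bundles using (Setoid)
import Relation.Binary.Construct.Add.Infimum.NonStrict as Infimum
import Relation.Binary.Construct.NonStrictToStrict as ToStrict
import Relation.Binary.Construct.StrictToNonStrict as ToNonStrict
open import Relation.Binary.Core using (Rel)
open import Relation.Binary.Definitions using (Transitive; tri<; tri≈; tri>)
open import Relation.Binary.PropositionalEquality
  using (_≡_; _≢_; refl; sym; trans; cong; cong₂; subst; subst₂; isEquivalence)
open import Relation.Binary.Structures using (IsTotalOrder; IsStrictTotalOrder)
open import Relation.Nullary using (¬_; Dec; yes; no; does; contradiction)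
open import Relation.Nullary.Construct.Add.Infimum using (_₋; ⊥₋; [_]; []-injective)
open import Relation.Unary
  using (Pred; U; _∈_; _⊆_; _⊂_; _⟨×⟩_; ∅; Satisfiable)
open import Relation.Unary.Polymorphic using () renaming (U to Uₚ)

private
  variable
    a b ℓ₁ ℓ₂ : Level

module _ (cl : Classical) where
  open Classical cl

  em : ∀ {ℓ} {P : Set ℓ} → Dec P
  em = excludedMiddle

  dne : ∀ {ℓ} {P : Set ℓ} → ¬ ¬ P → P
  dne {P = P} ¬¬p with em {P = P}
  ... | yes p = p
  ... | no ¬p = contradiction ¬p ¬¬p

  ¬∀⇒∃¬ : ∀ {p} {A : Set a} {P : A → Set p} → ¬ (∀ x → P x) → ∃[ x ] ¬ P x
  ¬∀⇒∃¬ ¬∀ = dne λ ¬∃ → ¬∀ λ x → dne λ ¬p → ¬∃ (x , ¬p)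

  -- The Cantor-Schröder-Bernstein theorem for setoids

  module _ {X : Setoid a ℓ₁} {Y : Setoid b ℓ₂} (f : Injection X Y) (g : Injection Y X) where
    private
      module X = Setoid X
      module Y = Setoid Y
      module f = Injection f
      module g = Injection g

    -- The points reached from outside the range of g by iterating g ∘ f.  The
    -- bijection is f on these points and the inverse of g elsewhere.
    data Chain : X.Carrier → Set (a ⊔ b ⊔ ℓ₁) where
      origin : ∀ {x} → (∀ y → ¬ (g.to y X.≈ x)) → Chain x
      next   : ∀ {x x′} → Chain x → g.to (f.to x) X.≈ x′ → Chain x′

    -- The graph of that bijection.
    Graph : X.Carrier → Y.Carrier → Set (a ⊔ b ⊔ ℓ₁ ⊔ ℓ₂)
    Graph x y = (Chain x × f.to x Y.≈ y) ⊎ (¬ Chain x × g.to y X.≈ x)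

    private
      chain-resp : ∀ {x x′} → x X.≈ x′ → Chain x → Chain x′
      chain-resp x≈x′ (origin ∉g) = origin λ y e → ∉g y (X.trans e (X.sym x≈x′))
      chain-resp x≈x′ (next c e)  = next c (X.trans e x≈x′)

      graph-total : ∀ x → ∃[ y ] Graph x y
      graph-total x with em {P = Chain x}
      ... | yes c = f.to x , inj₁ (c , Y.refl)
      ... | no ¬c = case dne (λ ∉g → ¬c (origin λ y e → ∉g (y , e))) of λ where
        (y , e) → y , inj₂ (¬c , e)

      graph-functional : ∀ {x x′ y y′} → Graph x y → Graph x′ y′ → x X.≈ x′ → y Y.≈ y′
      graph-functional (inj₁ (_ , e))  (inj₁ (_ , e′))   x≈x′ =
        Y.trans (Y.sym e) (Y.trans (f.cong x≈x′) e′)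
      graph-functional (inj₁ (c , _))  (inj₂ (¬c′ , _))  x≈x′ = contradiction (chain-resp x≈x′ c) ¬c′
      graph-functional (inj₂ (¬c , _)) (inj₁ (c′ , _))   x≈x′ =
        contradiction (chain-resp (X.sym x≈x′) c′) ¬c
      graph-functional (inj₂ (_ , e))  (inj₂ (_ , e′))   x≈x′ =
        g.injective (X.trans e (X.trans x≈x′ (X.sym e′)))

      graph-injective : ∀ {x x′ y y′} → Graph x y → Graph x′ y′ → y Y.≈ y′ → x X.≈ x′
      graph-injective (inj₁ (_ , e))  (inj₁ (_ , e′))  y≈y′ =
        f.injective (Y.trans e (Y.trans y≈y′ (Y.sym e′)))
      graph-injective (inj₁ (c , e))  (inj₂ (¬c′ , e′)) y≈y′ =
        contradiction (next c (X.trans (g.cong (Y.trans e y≈y′)) e′)) ¬c′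
      graph-injective (inj₂ (¬c , e)) (inj₁ (c′ , e′)) y≈y′ =
        contradiction (next c′ (X.trans (g.cong (Y.trans e′ (Y.sym y≈y′))) e)) ¬c
      graph-injective (inj₂ (_ , e))  (inj₂ (_ , e′))  y≈y′ =
        X.trans (X.sym e) (X.trans (g.cong y≈y′) e′)

      graph-surjective : ∀ y → ∃[ x ] Graph x y
      graph-surjective y with em {P = Chain (g.to y)}
      ... | yes (origin ∉g)        = contradiction X.refl (∉g y)
      ... | yes (next {x = x} c e) = x , inj₁ (c , g.injective e)
      ... | no ¬c                  = g.to y , inj₂ (¬c , X.refl)

    cantorSchröderBernstein : Bijection X Y
    cantorSchröderBernstein = record
      { to        = λ x → proj₁ (graph-total x)
      ; cong      = λ {x} {x′} → graph-functional (proj₂ (graph-total x)) (proj₂ (graph-total x′))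
      ; bijective =
          (λ {x} {x′} → graph-injective (proj₂ (graph-total x)) (proj₂ (graph-total x′)))
        , λ y → proj₁ (graph-surjective y) ,
            λ {z} → graph-functional (proj₂ (graph-total z)) (proj₂ (graph-surjective y))
      }

  -- Cardinal arithmetic: pairs of elements of a well-ordered set

  -- A has at most as many elements as B.  The map is total on X, and only its
  -- values on A matter, so that no proofs of membership are compared.
  infix 4 _≼_

  record _≼_ {X Y : Set} (A : Pred X 0ℓ) (B : Pred Y 0ℓ) : Set where
    field
      fun    : X → Y
      mapsTo : ∀ {x} → x ∈ A → fun x ∈ B
      injOn  : ∀ {x y} → x ∈ A → y ∈ A → fun x ≡ fun y → x ≡ y

  open _≼_

  private
    variable
      X Y Z W : Set

  ≼-trans : {A : Pred X 0ℓ} {B : Pred Y 0ℓ} {C : Pred Z 0ℓ} → A ≼ B → B ≼ C → A ≼ C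
  ≼-trans f g = record
    { fun    = g .fun ∘ f .fun
    ; mapsTo = g .mapsTo ∘ f .mapsTo
    ; injOn  = λ x∈A y∈A e → f .injOn x∈A y∈A (g .injOn (f .mapsTo x∈A) (f .mapsTo y∈A) e)
    }

  ⊆⇒≼ : {A B : Pred X 0ℓ} → A ⊆ B → A ≼ B
  ⊆⇒≼ A⊆B = record { fun = id ; mapsTo = A⊆B ; injOn = λ _ _ e → e }

  ×-mono-≼ : {A : Pred X 0ℓ} {B : Pred Y 0ℓ} {C : Pred Z 0ℓ} {D : Pred W 0ℓ} →
             A ≼ C → B ≼ D → (A ⟨×⟩ B) ≼ (C ⟨×⟩ D)
  ×-mono-≼ f g = record
    { fun    = λ (x , y) → f .fun x , g .fun y
    ; mapsTo = λ (x∈A , y∈B) → f .mapsTo x∈A , g .mapsTo y∈B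
    ; injOn  = λ (x∈A , y∈B) (x′∈A , y′∈B) e →
        cong₂ _,_ (f .injOn x∈A x′∈A (,-injectiveˡ e)) (g .injOn y∈B y′∈B (,-injectiveʳ e))
    }

  -- There are at most as many pairs of elements of A as elements of A.
  Square : Pred X 0ℓ → Set
  Square A = (A ⟨×⟩ A) ≼ A

  square-≼ : {A : Pred X 0ℓ} {B : Pred Y 0ℓ} → A ≼ B → B ≼ A → Square B → Square A
  square-≼ f g sq = ≼-trans (×-mono-≼ f f) (≼-trans sq g)

  -- A choice of preimages; x₀ is the value outside B.
  image⇒≼ : {A : Pred X 0ℓ} {B : Pred Y 0ℓ} → X → (r : X → Y) → B ⊆ Image r A → B ≼ A
  image⇒≼ {X = X} {A = A} {B} x₀ r cover = record
    { fun    = λ y → choose y em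
    ; mapsTo = λ {y} y∈B → proj₁ (choose-spec y em y∈B)
    ; injOn  = λ {y} {y′} y∈B y′∈B e →
        trans (sym (proj₂ (choose-spec y em y∈B)))
              (trans (cong r e) (proj₂ (choose-spec y′ em y′∈B)))
    }
    where
    choose : ∀ y → Dec (y ∈ B) → X
    choose y (yes y∈B) = proj₁ (cover y∈B)
    choose y (no _)    = x₀

    choose-spec : ∀ y (d : Dec (y ∈ B)) → y ∈ B → choose y d ∈ A × r (choose y d) ≡ y
    choose-spec y (yes y∈B) _   = proj₂ (cover y∈B)
    choose-spec y (no y∉B)  y∈B = contradiction y∈B y∉B

  module _ {_<_ : Rel X 0ℓ} (wf : WellFounded _<_)
           (connected : ∀ x y → x ≢ y → x < y ⊎ y < x) where

    -- Going through A in order, send each element to a point of B that no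
    -- earlier element was sent to.
    greedy-≼ : (A : Pred X 0ℓ) (B : Pred Y 0ℓ) → Y →
               (∀ x → x ∈ A → ¬ (B ≼ λ y → y ∈ A × y < x)) → A ≼ B
    greedy-≼ {Y = Y} A B y₀ small = record
      { fun    = r
      ; mapsTo = λ x∈A → proj₁ (r-fresh x∈A)
      ; injOn  = λ {x} {y} x∈A y∈A e → dne λ x≢y → case connected x y x≢y of λ where
          (inj₁ x<y) → proj₂ (r-fresh y∈A) x x∈A x<y e
          (inj₂ y<x) → proj₂ (r-fresh x∈A) y y∈A y<x (sym e)
      }
      where
      -- The value y at x is admissible when the earlier values are given by s.
      Fresh : X → (X → Y) → Y → Set
      Fresh x s y = y ∈ B × (∀ x′ → x′ ∈ A → x′ < x → s x′ ≢ y)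

      fresh : ∀ x s → x ∈ A → ∃[ y ] Fresh x s y
      fresh x s x∈A = dne λ ¬∃ → small x x∈A (image⇒≼ x s λ {y} y∈B →
        dne λ y∉im → ¬∃ (y , y∈B , λ x′ x′∈A x′<x e → y∉im (x′ , (x′∈A , x′<x) , e)))

      -- Earlier values, extended to a total function by y₀.
      extendBy : ∀ {x} → WfRec _<_ (λ _ → Y) x → ∀ y → Dec (y < x) → Y
      extendBy rec y (yes y<x) = rec y<x
      extendBy rec y (no _)    = y₀

      next-value : ∀ x → (X → Y) → Dec (x ∈ A) → Y
      next-value x s (yes x∈A) = proj₁ (fresh x s x∈A)
      next-value x s (no _)    = y₀

      step : ∀ x → WfRec _<_ (λ _ → Y) x → Y
      step x rec = next-value x (λ y → extendBy rec y em) em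

      extendBy-cong : ∀ {x} {rec rec′ : WfRec _<_ (λ _ → Y) x} →
                      (∀ {y} y<x → rec {y} y<x ≡ rec′ y<x) →
                      ∀ y d → extendBy rec y d ≡ extendBy rec′ y d
      extendBy-cong h y (yes y<x) = h y<x
      extendBy-cong h y (no _)    = refl

      step-ext : ∀ x {rec rec′ : WfRec _<_ (λ _ → Y) x} →
                 (∀ {y} y<x → rec {y} y<x ≡ rec′ y<x) → step x rec ≡ step x rec′
      step-ext x h = cong (λ s → next-value x s em) (extensionality λ y → extendBy-cong h y em)

      r : X → Y
      r = WF.All.wfRec wf 0ℓ (λ _ → Y) step

      extendBy-r : ∀ {x y} (d : Dec (y < x)) → y < x → extendBy {x} (λ {z} _ → r z) y d ≡ r y
      extendBy-r (yes _)   _   = refl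
      extendBy-r (no y≮x) y<x = contradiction y<x y≮x

      next-value-fresh : ∀ x s (d : Dec (x ∈ A)) → x ∈ A → Fresh x s (next-value x s d)
      next-value-fresh x s (yes x∈A) _   = proj₂ (fresh x s x∈A)
      next-value-fresh x s (no x∉A)  x∈A = contradiction x∈A x∉A

      r-fresh : ∀ {x} → x ∈ A → Fresh x r (r x)
      r-fresh {x} x∈A = subst (Fresh x r) (sym (WF.FixPoint.unfold-wfRec wf (λ _ → Y) step step-ext))
        (map₂ (λ new x′ x′∈A x′<x e → new x′ x′∈A x′<x (trans (extendBy-r em x′<x) e))
              (next-value-fresh x _ em x∈A))

  -- The pair (m, n) is coded by 2 ^ m * (2 * n + 1).
  pairℕ : ℕ → ℕ → ℕ
  pairℕ zero      n = ℕ.suc (2 ℕ.* n)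
  pairℕ (ℕ.suc m) n = 2 ℕ.* pairℕ m n

  pairℕ-injective : ∀ m n m′ n′ → pairℕ m n ≡ pairℕ m′ n′ → m ≡ m′ × n ≡ n′
  pairℕ-injective zero      n zero       n′ e = refl , ℕ.*-cancelˡ-≡ n n′ 2 (ℕ.suc-injective e)
  pairℕ-injective zero      n (ℕ.suc m′) n′ e = contradiction (sym e) (ℕ.even≢odd (pairℕ m′ n′) n)
  pairℕ-injective (ℕ.suc m) n zero       n′ e = contradiction e (ℕ.even≢odd (pairℕ m n) n′)
  pairℕ-injective (ℕ.suc m) n (ℕ.suc m′) n′ e =
    let m≡m′ , n≡n′ = pairℕ-injective m n m′ n′ (ℕ.*-cancelˡ-≡ _ _ 2 e) in cong ℕ.suc m≡m′ , n≡n′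

  module _ {_<_ : Rel X 0ℓ} (sto : IsStrictTotalOrder _≡_ _<_) (wf : WellFounded _<_) where
    private
      module < = IsStrictTotalOrder sto

      -- The natural numbers are put below X to avoid finite initial segments:
      -- ℕ together with an initial segment of X is always infinite.
      V : Set
      V = ℕ ⊎ X

      _<ᵥ_ : Rel V 0ℓ
      _<ᵥ_ = ℕ._<_ ⊎-< _<_

      _≤ᵥ_ : Rel V 0ℓ
      u ≤ᵥ v = u <ᵥ v ⊎ u ≡ v

      <ᵥ-compare : ∀ u v → u <ᵥ v ⊎ u ≡ v ⊎ v <ᵥ u
      <ᵥ-compare u v with LeftOrder.⊎-<-trichotomous ℕ.<-cmp <.compare u v
      ... | tri< u<v _ _ = inj₁ u<v
      ... | tri≈ _ u≈v _ = inj₂ (inj₁ (Pointwise-≡⇒≡ u≈v))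
      ... | tri> _ _ v<u = inj₂ (inj₂ v<u)

      -- A subset D of X together with the whole of ℕ.
      ℕ∪ : Pred X 0ℓ → Pred V 0ℓ
      ℕ∪ D (inj₁ _) = ⊤
      ℕ∪ D (inj₂ x) = x ∈ D

      -- The elements of X below a given point of V.
      below : V → Pred X 0ℓ
      below (inj₁ _) = ∅
      below (inj₂ x) = _< x

      square-ℕ : ∀ n → Square (ℕ∪ (below (inj₁ n)))
      square-ℕ n = record
        { fun    = λ (u , v) → inj₁ (pairℕ (index u) (index v))
        ; mapsTo = λ _ → tt
        ; injOn  = λ { {inj₁ m , inj₁ n} {inj₁ m′ , inj₁ n′} _ _ e →
            let m≡m′ , n≡n′ = pairℕ-injective m n m′ n′ (inj₁-injective e)
            in cong₂ (λ m n → inj₁ m , inj₁ n) m≡m′ n≡n′ }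
        }
        where
        index : V → ℕ
        index (inj₁ m) = m
        index (inj₂ _) = 0

      -- One more point does not change the size of an infinite set.
      ≤ᵥ-≼-below : ∀ v → (_≤ᵥ v) ≼ ℕ∪ (below v)
      ≤ᵥ-≼-below (inj₁ n) = ⊆⇒≼ λ {u} → ∈ℕ u
        where
        ∈ℕ : ∀ u → u ≤ᵥ inj₁ n → u ∈ ℕ∪ ∅
        ∈ℕ (inj₁ _) _         = tt
        ∈ℕ (inj₂ _) (inj₁ ())
        ∈ℕ (inj₂ _) (inj₂ ())
      ≤ᵥ-≼-below (inj₂ x) = record
        { fun    = λ u → shift u em
        ; mapsTo = λ {u} → shift-∈ u em
        ; injOn  = λ {u} {v} _ _ → shift-injective u v em em
        }
        where
        -- The greatest element is moved to 0, and the natural numbers make room for it.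
        shift : ∀ u → Dec (u ≡ inj₂ x) → V
        shift (inj₁ n) _       = inj₁ (ℕ.suc n)
        shift (inj₂ y) (yes _) = inj₁ 0
        shift (inj₂ y) (no _)  = inj₂ y

        shift-∈ : ∀ u d → u ≤ᵥ inj₂ x → shift u d ∈ ℕ∪ (_< x)
        shift-∈ (inj₁ n) _       _                            = tt
        shift-∈ (inj₂ y) (yes _) _                            = tt
        shift-∈ (inj₂ y) (no _)  (inj₁ (LeftOrder.₂∼₂ y<x)) = y<x
        shift-∈ (inj₂ y) (no ¬e) (inj₂ e)                   = contradiction e ¬e

        shift-injective : ∀ u v d d′ → shift u d ≡ shift v d′ → u ≡ v
        shift-injective (inj₁ m) (inj₁ .m) _        _        refl = refl
        shift-injective (inj₁ m) (inj₂ z)  _        (yes _)  ()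
        shift-injective (inj₁ m) (inj₂ z)  _        (no _)   ()
        shift-injective (inj₂ y) (inj₁ n)  (yes _)  _        ()
        shift-injective (inj₂ y) (inj₁ n)  (no _)   _        ()
        shift-injective (inj₂ y) (inj₂ z)  (yes e)  (yes e′) _    = trans e (sym e′)
        shift-injective (inj₂ y) (inj₂ z)  (yes _)  (no _)   ()
        shift-injective (inj₂ y) (inj₂ z)  (no _)   (yes _)  ()
        shift-injective (inj₂ y) (inj₂ .y) (no _)   (no _)   refl = refl

      -- The lexicographic order on triples; the first component will be the
      -- maximum of the other two.
      _<₃_ : Rel (V × V × V) 0ℓ
      _<₃_ = Lex.×-Lex _≡_ _<ᵥ_ (Lex.×-Lex _≡_ _<ᵥ_ _<ᵥ_)

      <₃-wellFounded : WellFounded _<₃_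
      <₃-wellFounded = Lex.×-wellFounded wfᵥ (Lex.×-wellFounded wfᵥ wfᵥ)
        where
        wfᵥ : WellFounded _<ᵥ_
        wfᵥ = LeftOrder.⊎-<-wellFounded <-wellFounded wf

      <₃-connected : ∀ p q → p ≢ q → p <₃ q ⊎ q <₃ p
      <₃-connected (u , v , w) (u′ , v′ , w′) p≢q with <ᵥ-compare u u′
      ... | inj₁ u<u′          = inj₁ (inj₁ u<u′)
      ... | inj₂ (inj₂ u′<u)   = inj₂ (inj₁ u′<u)
      ... | inj₂ (inj₁ refl) with <ᵥ-compare v v′
      ...   | inj₁ v<v′        = inj₁ (inj₂ (refl , inj₁ v<v′))
      ...   | inj₂ (inj₂ v′<v) = inj₂ (inj₂ (refl , inj₁ v′<v))
      ...   | inj₂ (inj₁ refl) with <ᵥ-compare w w′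
      ...     | inj₁ w<w′        = inj₁ (inj₂ (refl , inj₂ (refl , w<w′)))
      ...     | inj₂ (inj₂ w′<w) = inj₂ (inj₂ (refl , inj₂ (refl , w′<w)))
      ...     | inj₂ (inj₁ refl) = contradiction refl p≢q

      ≤ᵥ-trans : ∀ {u v w} → u ≤ᵥ v → v ≤ᵥ w → u ≤ᵥ w
      ≤ᵥ-trans (inj₁ u<v)  (inj₁ v<w)  = inj₁ (LeftOrder.⊎-<-transitive ℕ.<-trans <.trans u<v v<w)
      ≤ᵥ-trans (inj₁ u<v)  (inj₂ refl) = inj₁ u<v
      ≤ᵥ-trans (inj₂ refl) v≤w         = v≤w

      -- If ℕ ∪ D is no larger than a proper initial segment of it, the claim is
      -- inherited from that segment.  Otherwise order the pairs by their
      -- maximum m, and list each pair together with m.  The triples preceding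
      -- a given one lie in the cube of the points up to m, hence are fewer than
      -- ℕ ∪ D, and the greedy map applies.
      square-step : (D : Pred X 0ℓ) → (∀ {x y} → x < y → y ∈ D → x ∈ D) →
                    (∀ v → v ∈ ℕ∪ D → Square (ℕ∪ (below v))) → Square (ℕ∪ D)
      square-step D closed ih
        with em {P = ∃[ v ] v ∈ ℕ∪ D × ℕ∪ D ≼ ℕ∪ (below v)}
      ... | yes (v , v∈D , D≼v) = square-≼ D≼v (⊆⇒≼ (λ {x} → below-⊆ v v∈D {x})) (ih v v∈D)
        where
        below-⊆ : ∀ v → v ∈ ℕ∪ D → ℕ∪ (below v) ⊆ ℕ∪ D
        below-⊆ v        v∈D {inj₁ _} _   = tt
        below-⊆ (inj₂ y) y∈D {inj₂ x} x<y = closed x<y y∈D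
      ... | no D⋠ = ≼-trans withMax
          (greedy-≼ <₃-wellFounded <₃-connected Triples (ℕ∪ D) (inj₁ 0) λ (m , _) (m∈D , _) D≼ →
            D⋠ (m , m∈D , ≼-trans D≼ (≼-trans (⊆⇒≼ (bounded m)) (cube m m∈D))))
        where
        -- The pairs (u, v) in ℕ ∪ D, with an upper bound m from ℕ ∪ D.
        Triples : Pred (V × V × V) 0ℓ
        Triples (m , u , v) = m ∈ ℕ∪ D × u ≤ᵥ m × v ≤ᵥ m

        withMax : (ℕ∪ D ⟨×⟩ ℕ∪ D) ≼ Triples
        withMax = record
          { fun    = λ (u , v) → max u v , u , v
          ; mapsTo = λ {(u , v)} → max-spec u v
          ; injOn  = λ _ _ → ,-injectiveʳ
          }
          where
          max : V → V → V
          max u v with <ᵥ-compare u v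
          ... | inj₁ _        = v
          ... | inj₂ (inj₁ _) = v
          ... | inj₂ (inj₂ _) = u

          max-spec : ∀ u v → u ∈ ℕ∪ D × v ∈ ℕ∪ D → Triples (max u v , u , v)
          max-spec u v (u∈D , v∈D) with <ᵥ-compare u v
          ... | inj₁ u<v        = v∈D , inj₁ u<v , inj₂ refl
          ... | inj₂ (inj₁ u≡v) = v∈D , inj₂ u≡v , inj₂ refl
          ... | inj₂ (inj₂ v<u) = u∈D , inj₂ refl , inj₁ v<u

        bounded : ∀ m {u v} →
          (λ p → p ∈ Triples × p <₃ (m , u , v)) ⊆ ((_≤ᵥ m) ⟨×⟩ (_≤ᵥ m) ⟨×⟩ (_≤ᵥ m))
        bounded m ((_ , u≤ , v≤) , inj₁ <m)         = inj₁ <m , ≤ᵥ-trans u≤ (inj₁ <m) , ≤ᵥ-trans v≤ (inj₁ <m)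
        bounded m ((_ , u≤ , v≤) , inj₂ (refl , _)) = inj₂ refl , u≤ , v≤

        cube : ∀ m → m ∈ ℕ∪ D → ((_≤ᵥ m) ⟨×⟩ (_≤ᵥ m) ⟨×⟩ (_≤ᵥ m)) ≼ ℕ∪ (below m)
        cube m m∈D = ≼-trans (×-mono-≼ one (×-mono-≼ one one)) (≼-trans (×-mono-≼ (⊆⇒≼ id) sq) sq)
          where
          one = ≤ᵥ-≼-below m
          sq  = ih m m∈D

      square-below : ∀ v → Square (ℕ∪ (below v))
      square-below (inj₁ n) = square-ℕ n
      square-below (inj₂ x) = WF.All.wfRec wf 0ℓ (λ x → Square (ℕ∪ (_< x))) step x
        where
        step : ∀ x → (∀ {y} → y < x → Square (ℕ∪ (_< y))) → Square (ℕ∪ (_< x))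
        step x ih = square-step (_< x) <.trans λ where
          (inj₁ n) _   → square-ℕ n
          (inj₂ y) y<x → ih y<x

    ℕ⊎-square : ((ℕ ⊎ X) × (ℕ ⊎ X)) ↣ (ℕ ⊎ X)
    ℕ⊎-square = mk↣ {to = sq .fun} λ {p} {q} → sq .injOn (all p) (all q)
      where
      sq = square-step U (λ _ _ → tt) (λ v _ → square-below v)
      all : ∀ p → p ∈ (ℕ∪ U ⟨×⟩ ℕ∪ U)
      all (inj₁ _ , inj₁ _) = tt , tt
      all (inj₁ _ , inj₂ _) = tt , tt
      all (inj₂ _ , inj₁ _) = tt , tt
      all (inj₂ _ , inj₂ _) = tt , tt

  ℕ⊎-absorb : ℕ ↣ X → (ℕ ⊎ X) ↣ X
  ℕ⊎-absorb {X = X} ι = mk↣ {to = λ u → shift u em} λ {u} {v} → shift-injective u v em em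
    where
    module ι = Injection ι

    -- The elements other than those of X outside the copy of ℕ.
    Moved : ℕ ⊎ X → Set
    Moved (inj₁ _) = ⊤
    Moved (inj₂ x) = ∃[ n ] ι.to n ≡ x

    -- Within the copy of ℕ in X, the old elements go to the odd places and the
    -- new ones to the even places.
    shift : ∀ u → Dec (Moved u) → X
    shift (inj₁ n) _             = ι.to (2 ℕ.* n)
    shift (inj₂ x) (yes (n , _)) = ι.to (ℕ.suc (2 ℕ.* n))
    shift (inj₂ x) (no _)        = x

    shift-injective : ∀ u v d d′ → shift u d ≡ shift v d′ → u ≡ v
    shift-injective (inj₁ m) (inj₁ n) _ _ e = cong inj₁ (ℕ.*-cancelˡ-≡ m n 2 (ι.injective e))
    shift-injective (inj₁ m) (inj₂ y) _ (yes (n , _)) e = contradiction (ι.injective e) (ℕ.even≢odd m n)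
    shift-injective (inj₁ m) (inj₂ y) _ (no ¬moved) e = contradiction (_ , e) ¬moved
    shift-injective (inj₂ x) (inj₁ n) (yes (m , _)) _ e = contradiction (sym (ι.injective e)) (ℕ.even≢odd n m)
    shift-injective (inj₂ x) (inj₁ n) (no ¬moved) _ e = contradiction (_ , sym e) ¬moved
    shift-injective (inj₂ x) (inj₂ y) (yes (m , ιm≡x)) (yes (n , ιn≡y)) e =
      cong inj₂ (trans (sym ιm≡x) (trans (cong ι.to m≡n) ιn≡y))
      where m≡n = ℕ.*-cancelˡ-≡ m n 2 (ℕ.suc-injective (ι.injective e))
    shift-injective (inj₂ x) (inj₂ y) (yes _)     (no ¬moved) e = contradiction (_ , e) ¬moved
    shift-injective (inj₂ x) (inj₂ y) (no ¬moved) (yes _)     e = contradiction (_ , sym e) ¬moved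
    shift-injective (inj₂ x) (inj₂ y) (no _)      (no _)      e = cong inj₂ e

  -- Linear orders

  module Order {A : Set} (L : LinearOrder A) where
    open LinearOrder L public
    open IsTotalOrder isTotalOrder public
      using (isPartialOrder; antisym; total; ≤-respˡ-≈; ≤-respʳ-≈)
      renaming (refl to ≤-refl; trans to ≤-trans)

    private
      variable
        x y z : A

    <-trans : x < y → y < z → x < z
    <-trans = ToStrict.<-trans _≡_ _≤_ isPartialOrder

    ≤-<-trans : x ≤ y → y < z → x < z
    ≤-<-trans = ToStrict.≤-<-trans _≡_ _≤_ ≤-trans antisym ≤-respˡ-≈

    <⇒≱ : x < y → ¬ (y ≤ x)
    <⇒≱ = ToStrict.<⇒≱ _≡_ _≤_ antisym

    compare : ∀ x y → x < y ⊎ x ≡ y ⊎ y < x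
    compare x y with ToStrict.<-trichotomous _≡_ _≤_ sym (λ _ _ → em) antisym total x y
    ... | tri< x<y _ _ = inj₁ x<y
    ... | tri≈ _ x≡y _ = inj₂ (inj₁ x≡y)
    ... | tri> _ _ y<x = inj₂ (inj₂ y<x)

    ≮⇒≥ : ¬ (x < y) → y ≤ x
    ≮⇒≥ = ToStrict.≮⇒≥ _≡_ _≤_ sym (λ _ _ → em) (λ { refl → ≤-refl }) total

    -- y is the immediate successor of x.
    infix 4 _⋖_

    _⋖_ : Rel A 0ℓ
    x ⋖ y = x < y × (∀ z → x < z → ¬ (z < y))

  private
    variable
      A B C I : Set

  strictlyMonotone⇒embedding :
    (L : LinearOrder A) (L′ : LinearOrder B) {f : A → B} →
    (∀ {x y} → LinearOrder._<_ L x y → LinearOrder._<_ L′ (f x) (f y)) → IsEmbedding L L′ f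
  strictlyMonotone⇒embedding L L′ {f} mono x y = mk⇔ preserves reflects
    where
    module L  = Order L
    module L′ = Order L′

    preserves : x L.≤ y → f x L′.≤ f y
    preserves x≤y with L.compare x y
    ... | inj₁ x<y         = proj₁ (mono x<y)
    ... | inj₂ (inj₁ refl) = L′.≤-refl
    ... | inj₂ (inj₂ y<x)  = contradiction x≤y (L.<⇒≱ y<x)

    reflects : f x L′.≤ f y → x L.≤ y
    reflects fx≤fy = L.≮⇒≥ λ y<x → L′.<⇒≱ (mono y<x) fx≤fy

  module Embedding {L : LinearOrder A} {L′ : LinearOrder B} {f : A → B}
                   (emb : IsEmbedding L L′ f) where
    private
      module L  = Order L
      module L′ = Order L′

    mono-≤ : ∀ {x y} → x L.≤ y → f x L′.≤ f y
    mono-≤ {x} {y} = Equivalence.to (emb x y)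

    cancel-≤ : ∀ {x y} → f x L′.≤ f y → x L.≤ y
    cancel-≤ {x} {y} = Equivalence.from (emb x y)

    mono-< : ∀ {x y} → x L.< y → f x L′.< f y
    mono-< (x≤y , x≢y) = mono-≤ x≤y , λ e →
      x≢y (L.antisym x≤y (cancel-≤ (L′.≤-respʳ-≈ (sym e) L′.≤-refl)))

    cancel-< : ∀ {x y} → f x L′.< f y → x L.< y
    cancel-< (fx≤fy , fx≢fy) = cancel-≤ fx≤fy , fx≢fy ∘ cong f

    injective : ∀ {x y} → f x ≡ f y → x ≡ y
    injective e = L.antisym (cancel-≤ (L′.≤-respʳ-≈ e L′.≤-refl))
                            (cancel-≤ (L′.≤-respʳ-≈ (sym e) L′.≤-refl))

  -- An embedding onto a convex subset.
  infix 4 _⊑_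

  record _⊑_ {A B : Set} (L : LinearOrder A) (L′ : LinearOrder B) : Set where
    open LinearOrder L′ using (_≤_)
    field
      to      : A → B
      embeds  : IsEmbedding L L′ to
      convex  : ∀ {x y z} → to x ≤ y → y ≤ to z → ∃[ w ] to w ≡ y

    open Embedding {L = L} {L′} embeds public

  ⊑-trans : {L : LinearOrder A} {L′ : LinearOrder B} {L″ : LinearOrder C} →
            L ⊑ L′ → L′ ⊑ L″ → L ⊑ L″
  ⊑-trans {L″ = L″} f g = record
    { to     = g.to ∘ f.to
    ; embeds = λ x y → mk⇔ (g.mono-≤ ∘ f.mono-≤) (f.cancel-≤ ∘ g.cancel-≤)
    ; convex = λ gfx≤y y≤gfz → case g.convex gfx≤y y≤gfz of λ where
        (w , refl) → case f.convex (g.cancel-≤ gfx≤y) (g.cancel-≤ y≤gfz) of λ where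
          (v , fv≡w) → v , cong g.to fv≡w
    }
    where
    module f = _⊑_ f
    module g = _⊑_ g

  module _ {L : LinearOrder A} {L′ : LinearOrder B} (f : L ⊑ L′) where
    private
      module L  = Order L
      module L′ = Order L′
      module f  = _⊑_ f

    ⋖-map : ∀ {x y} → x L.⋖ y → f.to x L′.⋖ f.to y
    ⋖-map (x<y , gap) = f.mono-< x<y , λ z fx<z z<fy →
      case f.convex (proj₁ fx<z) (proj₁ z<fy) of λ where
        (w , refl) → gap w (f.cancel-< fx<z) (f.cancel-< z<fy)

    ⋖-cancel : ∀ {x y} → f.to x L′.⋖ f.to y → x L.⋖ y
    ⋖-cancel (fx<fy , gap) = f.cancel-< fx<fy , λ z x<z z<y → gap _ (f.mono-< x<z) (f.mono-< z<y)

  -- The order on A that makes the bijection an isomorphism.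
  pullback : A ↔ B → LinearOrder B → LinearOrder A
  pullback φ L = record
    { _≤_          = λ x y → to x ≤ to y
    ; isTotalOrder = record
      { isPartialOrder = record
        { isPreorder = record
          { isEquivalence = isEquivalence
          ; reflexive     = λ { refl → ≤-refl }
          ; trans         = ≤-trans
          }
        ; antisym = λ p q → Injection.injective (↔⇒↣ φ) (antisym p q)
        }
      ; total = λ x y → total (to x) (to y)
      }
    }
    where
    open Order L
    open Inverse φ using (to)

  ⊑-pullback : (φ : A ↔ B) (L : LinearOrder B) → L ⊑ pullback φ L
  ⊑-pullback φ L = record
    { to     = from
    ; embeds = λ x y → mk⇔ (subst₂ _≤_ (sym (strictlyInverseˡ x)) (sym (strictlyInverseˡ y)))
                           (subst₂ _≤_ (strictlyInverseˡ x) (strictlyInverseˡ y))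
    ; convex = λ {_} {y} _ _ → to y , strictlyInverseʳ y
    }
    where
    open LinearOrder L
    open Inverse φ

  -- Sums of linear orders

  module _ {J : Set} (K : LinearOrder J) {F : J → Set} (L : ∀ k → LinearOrder (F k)) where
    private
      module K = Order K
      module L k = Order (L k)

    -- The lexicographic order on the sum of the L k over k in K.
    data _≤Σ_ : Rel (Σ J F) 0ℓ where
      outer : ∀ {k k′ x y} → k K.< k′ → (k , x) ≤Σ (k′ , y)
      inner : ∀ {k x y} → L._≤_ k x y → (k , x) ≤Σ (k , y)

    sumOrder : LinearOrder (Σ J F)
    sumOrder = record
      { _≤_          = _≤Σ_
      ; isTotalOrder = record
        { isPartialOrder = record
          { isPreorder = record
            { isEquivalence = isEquivalence
            ; reflexive     = λ { refl → inner (L.≤-refl _) }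
            ; trans         = ≤-trans
            }
          ; antisym = ≤-antisym
          }
        ; total = ≤-total
        }
      }
      where
      ≤-trans : ∀ {p q r} → p ≤Σ q → q ≤Σ r → p ≤Σ r
      ≤-trans (outer p) (outer q) = outer (K.<-trans p q)
      ≤-trans (outer p) (inner q) = outer p
      ≤-trans (inner p) (outer q) = outer q
      ≤-trans (inner p) (inner q) = inner (L.≤-trans _ p q)

      ≤-antisym : ∀ {p q} → p ≤Σ q → q ≤Σ p → p ≡ q
      ≤-antisym (outer p) (outer q) = contradiction (proj₁ q) (K.<⇒≱ p)
      ≤-antisym (outer p) (inner q) = contradiction refl (proj₂ p)
      ≤-antisym (inner p) (outer q) = contradiction refl (proj₂ q)
      ≤-antisym (inner p) (inner q) = cong (_ ,_) (L.antisym _ p q)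

      ≤-total : ∀ p q → p ≤Σ q ⊎ q ≤Σ p
      ≤-total (k , x) (k′ , y) with K.compare k k′
      ... | inj₁ k<k′         = inj₁ (outer k<k′)
      ... | inj₂ (inj₂ k′<k)  = inj₂ (outer k′<k)
      ... | inj₂ (inj₁ refl) with L.total k x y
      ...   | inj₁ x≤y = inj₁ (inner x≤y)
      ...   | inj₂ y≤x = inj₂ (inner y≤x)

    private
      module S = Order sumOrder

    outer-< : ∀ {k k′ x y} → k K.< k′ → (k , x) S.< (k′ , y)
    outer-< k<k′ = outer k<k′ , λ { refl → proj₂ k<k′ refl }

    summand : ∀ k → L k ⊑ sumOrder
    summand k = record
      { to     = k ,_
      ; embeds = λ x y → mk⇔ inner λ where
          (outer k<k) → contradiction refl (proj₂ k<k)
          (inner x≤y) → x≤y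
      ; convex = λ where
          (outer k<l) (outer l<k) → contradiction (proj₁ l<k) (K.<⇒≱ k<l)
          (outer k<k) (inner _)   → contradiction refl (proj₂ k<k)
          (inner _)   _           → _ , refl
      }

    -- If x is not greatest in its summand, an immediate successor of x in the
    -- sum lies in the same summand.
    ⋖-summand : ∀ {k x p} → (∃[ y ] L._<_ k x y) → (k , x) S.⋖ p → ∃[ y ] L._⋖_ k x y
    ⋖-summand {k} (z , x<z) ((outer k<l , _) , gap) =
      contradiction (outer-< k<l) (gap (k , z) (_⊑_.mono-< (summand k) x<z))
    ⋖-summand {k} _ cov@((inner _ , _) , _) = _ , ⋖-cancel (summand k) cov

  -- Coding subsets of a well-order by linear orders

  -- The blocks of a code: ω for members and -∞ + ℤ for non-members.  The least
  -- point of a block is its only point without immediate predecessor, and only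
  -- in ω does it have an immediate successor.
  Block : Bool → Set
  Block true  = ℕ
  Block false = ℤ ₋

  block : ∀ b → LinearOrder (Block b)
  block true  = record { _≤_ = ℕ._≤_ ; isTotalOrder = ℕ.≤-isTotalOrder }
  block false = record { _≤_ = _≤₋_ ; isTotalOrder = ≤₋-isTotalOrder-≡ ℤ.≤-isTotalOrder }
    where open Infimum ℤ._≤_

  private
    module Block b = Order (block b)

  bottom : ∀ b → Block b
  bottom true  = 0
  bottom false = ⊥₋

  bottom-least : ∀ b x → Block._≤_ b (bottom b) x
  bottom-least true  n = ℕ.z≤n
  bottom-least false x = Infimum.⊥₋≤ x

  block-unbounded : ∀ b x → ∃[ y ] Block._<_ b x y
  block-unbounded true  n     = ℕ.suc n , ℕ.n≤1+n n , ℕ.<⇒≢ (ℕ.n<1+n n)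
  block-unbounded false ⊥₋    = [ ℤ.0ℤ ] , Infimum.⊥₋≤ _ , λ ()
  block-unbounded false [ i ] = [ ℤ.suc i ] , Infimum.[ ℤ.i≤suc[i] i ] , ℤ.i≢suc[i] ∘ []-injective

  pred-< : ∀ i → Block._<_ false [ ℤ.pred i ] [ i ]
  pred-< i = Infimum.[ ℤ.i≤j⇒pred[i]≤j ℤ.≤-refl ] ,
             λ e → ℤ.<-irrefl ([]-injective e) (ℤ.i≤pred[j]⇒i<j ℤ.≤-refl)

  bottom-or-⋖ : ∀ b x → x ≡ bottom b ⊎ ∃[ y ] Block._⋖_ b y x
  bottom-or-⋖ true  zero      = inj₁ refl
  bottom-or-⋖ true  (ℕ.suc n) = inj₂ (n , (ℕ.n≤1+n n , ℕ.<⇒≢ (ℕ.n<1+n n)) , λ where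
    z (n≤z , n≢z) (z≤1+n , z≢1+n) →
      n≢z (ℕ.≤-antisym n≤z (ℕ.s≤s⁻¹ (ℕ.≤∧≢⇒< z≤1+n z≢1+n))))
  bottom-or-⋖ false ⊥₋        = inj₁ refl
  bottom-or-⋖ false [ i ]     = inj₂ ([ ℤ.pred i ] , pred-< i , λ where
    [ j ] (Infimum.[ pi≤j ] , pi≢j) (Infimum.[ j≤i ] , j≢i) →
      pi≢j (cong [_] (ℤ.≤-antisym pi≤j (ℤ.i<j⇒i≤pred[j] (ℤ.≤∧≢⇒< j≤i (j≢i ∘ cong [_]))))))

  bottom-⋖ : ∃[ y ] Block._⋖_ true (bottom true) y
  bottom-⋖ = case bottom-or-⋖ true 1 of λ where
    (inj₂ (zero , 0⋖1))                → 1 , 0⋖1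
    (inj₂ (ℕ.suc n , (n<1 , n≢1) , _)) → contradiction (ℕ.≤-antisym n<1 (ℕ.s≤s ℕ.z≤n)) n≢1

  bottom-⋖⇒true : ∀ b → ∃[ y ] Block._⋖_ b (bottom b) y → b ≡ true
  bottom-⋖⇒true true  _                    = refl
  bottom-⋖⇒true false (⊥₋ , (_ , ⊥≢⊥) , _) = contradiction refl ⊥≢⊥
  bottom-⋖⇒true false ([ i ] , _ , gap)    =
    contradiction (pred-< i) (gap [ ℤ.pred i ] (Infimum.⊥₋≤ _ , λ ()))

  block-countable : ∀ b → Block b ↣ ℕ
  block-countable true  = mk↣ {to = id} id
  block-countable false = mk↣ {to = index} λ {i} {j} → index-injective i j
    where
    index : ℤ ₋ → ℕ
    index ⊥₋              = 0
    index [ ℤ.+ n ]       = ℕ.suc (2 ℕ.* n)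
    index [ ℤ.-[1+ n ] ]  = 2 ℕ.* ℕ.suc n

    index-injective : ∀ i j → index i ≡ index j → i ≡ j
    index-injective ⊥₋             ⊥₋             _ = refl
    index-injective ⊥₋             [ ℤ.+ n ]      ()
    index-injective ⊥₋             [ ℤ.-[1+ n ] ] ()
    index-injective [ ℤ.+ m ]      [ ℤ.+ n ]      e =
      cong (λ n → [ ℤ.+ n ]) (ℕ.*-cancelˡ-≡ m n 2 (ℕ.suc-injective e))
    index-injective [ ℤ.+ m ]      [ ℤ.-[1+ n ] ] e = contradiction (sym e) (ℕ.even≢odd (ℕ.suc n) m)
    index-injective [ ℤ.-[1+ m ] ] [ ℤ.+ n ]      e = contradiction e (ℕ.even≢odd (ℕ.suc m) n)
    index-injective [ ℤ.-[1+ m ] ] [ ℤ.-[1+ n ] ] e =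
      cong (λ n → [ ℤ.-[1+ n ] ]) (ℕ.suc-injective (ℕ.*-cancelˡ-≡ (ℕ.suc m) (ℕ.suc n) 2 e))

  module Coding (J : LinearOrder I) (wf : WellFounded (LinearOrder._<_ J))
                {i₀ : I} (i₀-least : ∀ i → LinearOrder._≤_ J i₀ i) where
    private
      module J = Order J

    -- Subsets of I are given by their characteristic functions.
    Code : (I → Bool) → Set
    Code S = Σ I λ i → Block (S i)

    code : (S : I → Bool) → LinearOrder (Code S)
    code S = sumOrder J (λ i → block (S i))

    -- The least point of block i.
    start : ∀ S → I → Code S
    start S i = i , bottom (S i)

    module _ (S : I → Bool) where
      private
        module S = Order (code S)

      start-cancel-< : ∀ {i j} → start S i S.< start S j → i J.< j
      start-cancel-< (outer i<j , _)  = i<j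
      start-cancel-< (inner _   , ne) = contradiction refl ne

      start-least : ∀ x → start S i₀ S.≤ x
      start-least (i , x) with J.compare i₀ i
      ... | inj₁ i₀<i        = outer i₀<i
      ... | inj₂ (inj₁ refl) = inner (bottom-least (S i) x)
      ... | inj₂ (inj₂ i<i₀) = contradiction (i₀-least i) (J.<⇒≱ i<i₀)

      start-unbounded : ∀ i → ∃[ x ] start S i S.< x
      start-unbounded i =
        let y , b<y = block-unbounded (S i) (bottom (S i))
        in (i , y) , _⊑_.mono-< (summand J (block ∘ S) i) b<y

      start-limit : ∀ i p → ¬ (p S.⋖ start S i)
      start-limit i (j , x) ((outer j<i , _) , gap) =
        let y , x<y = block-unbounded (S j) x
        in gap (j , y) (_⊑_.mono-< (summand J (block ∘ S) j) x<y) (outer-< J (block ∘ S) j<i)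
      start-limit i (.i , x) ((inner x≤b , x≢b) , _) =
        x≢b (cong (i ,_) (Block.antisym (S i) x≤b (bottom-least (S i) x)))

      start-or-⋖ : ∀ x → (∃[ i ] x ≡ start S i) ⊎ (∃[ p ] p S.⋖ x)
      start-or-⋖ (i , x) with bottom-or-⋖ (S i) x
      ... | inj₁ refl      = inj₁ (i , refl)
      ... | inj₂ (p , p⋖x) = inj₂ ((i , p) , ⋖-map (summand J (block ∘ S) i) p⋖x)

      true⇒start-⋖ : ∀ {i} → S i ≡ true → ∃[ y ] start S i S.⋖ y
      true⇒start-⋖ {i} Si≡true =
        let y , b⋖y = subst (λ b → ∃[ y ] Block._⋖_ b (bottom b) y) (sym Si≡true) bottom-⋖
        in (i , y) , ⋖-map (summand J (block ∘ S) i) b⋖y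

      start-⋖⇒true : ∀ {i y} → start S i S.⋖ y → S i ≡ true
      start-⋖⇒true {i} s⋖y = bottom-⋖⇒true (S i)
        (⋖-summand J (block ∘ S) (block-unbounded (S i) (bottom (S i))) s⋖y)

    module _ {N : LinearOrder B} {S T : I → Bool} (f : code S ⊑ N) (g : code T ⊑ N) where
      private
        module S = Order (code S)
        module T = Order (code T)
        module N = Order N
        module f = _⊑_ f
        module g = _⊑_ g

      -- Otherwise f (start S i) lies between g (start T i₀) and g (start T i),
      -- hence is g y for some y < start T i.  If y were start T j, then j < i,
      -- and g y would be f (start S j) rather than f (start S i).  So y has an
      -- immediate predecessor, whereas start S i has none.
      ≮-start : f.to (start S i₀) ≡ g.to (start T i₀) →
                ∀ i → (∀ j → j J.< i → f.to (start S j) ≡ g.to (start T j)) →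
                ¬ (f.to (start S i) N.< g.to (start T i))
      ≮-start base i ih fs<gt = case g.convex g₀≤fs (proj₁ fs<gt) of absurd
        where
        g₀≤fs : g.to (start T i₀) N.≤ f.to (start S i)
        g₀≤fs = N.≤-respˡ-≈ base (f.mono-≤ (start-least S (start S i)))

        absurd : ¬ (∃[ y ] g.to y ≡ f.to (start S i))
        absurd (y , gy≡fs) with start-or-⋖ T y
        ... | inj₁ (j , refl) = proj₂ j<i (sym (cong proj₁ (f.injective {start S i} {start S j}
                                  (trans (sym gy≡fs) (sym (ih j j<i))))))
          where
          j<i : j J.< i
          j<i = start-cancel-< T (g.cancel-< (subst (N._< g.to (start T i)) (sym gy≡fs) fs<gt))
        ... | inj₂ (p , p⋖y) = case f.convex f₀≤gp (proj₁ (proj₁ gp⋖fs)) of λ where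
            (q , fq≡gp) → start-limit S i q
              (⋖-cancel f (subst (N._⋖ f.to (start S i)) (sym fq≡gp) gp⋖fs))
          where
          f₀≤gp : f.to (start S i₀) N.≤ g.to p
          f₀≤gp = N.≤-respˡ-≈ (sym base) (g.mono-≤ (start-least T p))

          gp⋖fs : g.to p N.⋖ f.to (start S i)
          gp⋖fs = subst (g.to p N.⋖_) gy≡fs (⋖-map g p⋖y)

      -- The immediate successor of start S i is not mapped above the image of any
      -- point above start T i, hence into the copy of code T.
      true-transfer : ∀ {i} → f.to (start S i) ≡ g.to (start T i) → S i ≡ true → T i ≡ true
      true-transfer {i} e Si≡true =
        let y , s⋖y = true⇒start-⋖ S Si≡true
            fs<fy , gap = subst (N._⋖ f.to y) e (⋖-map f s⋖y)
            z , t<z = start-unbounded T i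
            w , gw≡fy = g.convex (proj₁ fs<fy) (N.≮⇒≥ (gap (g.to z) (g.mono-< t<z)))
        in start-⋖⇒true T {y = w}
             (⋖-cancel g (subst (g.to (start T i) N.⋖_) (sym gw≡fy) (fs<fy , gap)))

    module _ {N : LinearOrder B} {S T : I → Bool} (f : code S ⊑ N) (g : code T ⊑ N) where
      private
        module N = Order N
        module f = _⊑_ f
        module g = _⊑_ g

      starts-agree : f.to (start S i₀) ≡ g.to (start T i₀) →
                     ∀ i → f.to (start S i) ≡ g.to (start T i)
      starts-agree base = WF.All.wfRec wf 0ℓ _ λ i ih →
        case N.compare (f.to (start S i)) (g.to (start T i)) of λ where
          (inj₁ f<g)        → contradiction f<g (≮-start f g base i λ j j<i → ih j<i)
          (inj₂ (inj₁ f≡g)) → f≡g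
          (inj₂ (inj₂ g<f)) → contradiction g<f (≮-start g f (sym base) i λ j j<i → sym (ih j<i))

      decode-unique : f.to (start S i₀) ≡ g.to (start T i₀) → ∀ i → S i ≡ T i
      decode-unique base i with S i in Si | T i in Ti
      ... | true  | true  = refl
      ... | false | false = refl
      ... | true  | false = trans (sym (true-transfer f g (starts-agree base i) Si)) Ti
      ... | false | true  = trans (sym Si) (true-transfer g f (sym (starts-agree base i)) Ti)

  -- Increasing families of convex copies under piecewise convex embeddings

  module _ {κ : InfiniteCardinal} {𝓛 : Pred (Lin κ) (suc 0ℓ)} (closed : DownwardClosed 𝓛)
           {K₀ : Lin κ} (K₀∉𝓛 : ¬ (K₀ ∈ 𝓛))
           {L : LinearOrder A} {D : LinearOrder B} (b₀ : B)
           (copy : Lin.Carrier K₀ → D ⊑ L)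
           (increasing : ∀ {m m′} → LinearOrder._<_ (Lin.order K₀) m m′ →
                         ∀ x y → LinearOrder._<_ L (_⊑_.to (copy m) x) (_⊑_.to (copy m′) y))
           where

    -- If L contains a K₀-sequence of convex copies of D and K₀ ∉ 𝓛, then some
    -- copy lies within one part of the partition.
    copies⇒⊑ : {N : LinearOrder C} → L ⊴[ 𝓛 ] N → D ⊑ N
    copies⇒⊑ {N = N} (K′ , K′∈𝓛 , part , isPartition , f , f-emb , f-convex)
      with em {P = ∃[ m ] ∃[ k ] (∀ x → _⊑_.to (copy m) x ∈ part k)}
    ... | yes (m , k , copy⊆part) = record
        { to     = f ∘ c.to
        ; embeds = λ x y → mk⇔ (f.mono-≤ ∘ c.mono-≤) (c.cancel-≤ ∘ f.cancel-≤)
        ; convex = λ {x} {y} {z} fx≤y y≤fz →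
            case f-convex k _ y _ fx≤y y≤fz (_ , copy⊆part x , refl) (_ , copy⊆part z , refl)
            of λ where
              (w , _ , refl) → case c.convex (f.cancel-≤ fx≤y) (f.cancel-≤ y≤fz) of λ where
                (v , cv≡w) → v , cong f cv≡w
        }
        where
        module c = _⊑_ (copy m)
        module f = Embedding {L = L} {N} f-emb
    ... | no split = contradiction (closed K₀ K′ (j , j-emb) K′∈𝓛) K₀∉𝓛
        where
        module L = Order L
        module K = Order (Lin.order K′)
        open IsConvexPartition isPartition

        at : Lin.Carrier K₀ → B → A
        at m = _⊑_.to (copy m)

        -- The index of the part containing a given point.
        piece : A → Lin.Carrier K′
        piece x = proj₁ (covers x)

        piece-mono : ∀ {x y} → x L.≤ y → piece x K.≤ piece y
        piece-mono {x} {y} x≤y = K.≮⇒≥ λ py<px →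
          L.<⇒≱ (Equivalence.to (ordered _ _) py<px y x (proj₂ (covers y)) (proj₂ (covers x))) x≤y

        -- The point b₀ of the copy lies in one part, some other point does not.
        meets-two : ∀ m → ∃[ x ] ∃[ y ] piece (at m x) K.< piece (at m y)
        meets-two m = case ¬∀⇒∃¬ (λ ⊆part → split (m , piece (at m b₀) , ⊆part)) of λ where
          (x , x∉) → case K.compare (piece (at m x)) (piece (at m b₀)) of λ where
            (inj₁ lt)        → x , b₀ , lt
            (inj₂ (inj₁ eq)) → contradiction (subst (λ k → at m x ∈ part k) eq (proj₂ (covers _))) x∉
            (inj₂ (inj₂ gt)) → b₀ , x , gt

        -- The upper of the two parts.  For a later copy the lower part is at
        -- least this one, so the upper part is strictly above it.
        j : Lin.Carrier K₀ → Lin.Carrier K′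
        j m = piece (at m (proj₁ (proj₂ (meets-two m))))

        j-emb : IsEmbedding (Lin.order K₀) (Lin.order K′) j
        j-emb = strictlyMonotone⇒embedding (Lin.order K₀) (Lin.order K′) λ {m} {m′} m<m′ →
          K.≤-<-trans (piece-mono (proj₁ (increasing m<m′ _ _))) (proj₂ (proj₂ (meets-two m′)))

  -- Linear orders on κ and subsets of κ

  module _ (κ : InfiniteCardinal) where
    private
      open InfiniteCardinal κ using (_<_; isStrictTotalOrder; wellFounded; infinite)

      V : Set
      V = ℕ ⊎ ∥ κ ∥

      module sq     = Injection (ℕ⊎-square isStrictTotalOrder wellFounded)
      module absorb = Injection (ℕ⊎-absorb infinite)

    κ-order : LinearOrder ∥ κ ∥
    κ-order = record { isTotalOrder = ToNonStrict.isTotalOrder _≡_ _<_ isStrictTotalOrder }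

    private
      module κ = Order κ-order

    κ-wellFounded : WellFounded κ._<_
    κ-wellFounded = WF.Subrelation.wellFounded (λ where
      (inj₁ x<y , _)   → x<y
      (inj₂ x≡y , x≢y) → contradiction x≡y x≢y) wellFounded

    κ-least : ∃[ i₀ ] (∀ i → i₀ κ.≤ i)
    κ-least =
      WF.All.wfRec wellFounded 0ℓ (λ _ → ∃[ i₀ ] (∀ i → i₀ κ.≤ i)) step (Injection.to infinite 0)
      where
      step : ∀ x → (∀ {y} → y < x → ∃[ i₀ ] (∀ i → i₀ κ.≤ i)) → ∃[ i₀ ] (∀ i → i₀ κ.≤ i)
      step x ih with em {P = ∃[ y ] y < x}
      ... | yes (y , y<x) = ih y<x
      ... | no minimal    = x , λ i → κ.≮⇒≥ λ where
        (inj₁ i<x , _)   → minimal (i , i<x)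
        (inj₂ i≡x , i≢x) → i≢x i≡x

    κ×κ↔κ : (∥ κ ∥ × ∥ κ ∥) ↔ ∥ κ ∥
    κ×κ↔κ = ⤖⇒↔ (cantorSchröderBernstein
      (mk↣ {to = λ (x , y) → absorb.to (sq.to (inj₂ x , inj₂ y))} λ e →
        let e′ = sq.injective (absorb.injective e)
        in cong₂ _,_ (inj₂-injective (,-injectiveˡ e′)) (inj₂-injective (,-injectiveʳ e′)))
      (mk↣ {to = λ x → x , x} ,-injectiveˡ))

    private
      i₀ : ∥ κ ∥
      i₀ = proj₁ κ-least

      Subset : Set
      Subset = ∥ κ ∥ → Bool

      open Coding κ-order κ-wellFounded (proj₂ κ-least)

      module pair = Inverse κ×κ↔κ

    -- The order relation as a subset of κ, through κ × κ ≈ κ.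
    graphOf : LinearOrder ∥ κ ∥ → Subset
    graphOf L x = let i , j = pair.from x in does (em {P = LinearOrder._≤_ L i j})

    LO-injection : (F : Pred (LinearOrder ∥ κ ∥) (suc 0ℓ)) →
                   Injection (Members (LO ∥ κ ∥) F) (2^ κ)
    LO-injection F = record
      { to        = graphOf ∘ proj₁
      ; cong      = λ L≈L′ x → does-cong em em (L≈L′ _ _)
      ; injective = λ {(L , _)} {(L′ , _)} e i j → does-cancel em em
          (subst (λ (i , j) → does (em {P = LinearOrder._≤_ L i j}) ≡
                              does (em {P = LinearOrder._≤_ L′ i j}))
                 (pair.strictlyInverseʳ (i , j)) (e (pair.to (i , j))))
      }
      where
      does-cong : {P Q : Set} (p : Dec P) (q : Dec Q) → P ⇔ Q → does p ≡ does q
      does-cong (yes _) (yes _) _   = refl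
      does-cong (no _)  (no _)  _   = refl
      does-cong (yes p) (no ¬q) P⇔Q = contradiction (Equivalence.to P⇔Q p) ¬q
      does-cong (no ¬p) (yes q) P⇔Q = contradiction (Equivalence.from P⇔Q q) ¬p

      does-cancel : {P Q : Set} (p : Dec P) (q : Dec Q) → does p ≡ does q → P ⇔ Q
      does-cancel (yes p) (yes q) _ = mk⇔ (λ _ → q) (λ _ → p)
      does-cancel (no ¬p) (no ¬q) _ = mk⇔ (λ p → contradiction p ¬p) (λ q → contradiction q ¬q)

    ≈⇒⊑ : {N N′ : LinearOrder A} → Setoid._≈_ (LO A) N N′ → N ⊑ N′
    ≈⇒⊑ N≈N′ = record { to = id ; embeds = N≈N′ ; convex = λ {_} {y} _ _ → y , refl }

    -- N contains a convex copy of code S with least point n.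
    CodedAt : LinearOrder ∥ κ ∥ → ∥ κ ∥ → Subset → Set
    CodedAt N n S = Σ (code S ⊑ N) λ f → _⊑_.to f (start S i₀) ≡ n

    CodedAt-unique : ∀ {N N′ n S T} → Setoid._≈_ (LO ∥ κ ∥) N N′ →
                     CodedAt N n S → CodedAt N′ n T → ∀ i → S i ≡ T i
    CodedAt-unique N≈N′ (f , fs≡n) (g , gs≡n) =
      decode-unique (⊑-trans f (≈⇒⊑ N≈N′)) g (trans fs≡n (sym gs≡n))

    -- A subset S is regarded as the sequence of its sections S (pair (n , _)).
    -- P is recovered at n from F if it is the n-th section of an S coded at the
    -- point n of some member of F.
    Recovered : Pred (LinearOrder ∥ κ ∥) (suc 0ℓ) → ∥ κ ∥ → Subset → Set₁
    Recovered F n P =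
      ∃[ N ] N ∈ F × ∃[ S ] CodedAt N n S × (∀ i → S (pair.to (n , i)) ≡ P i)

    -- Otherwise each n misses some P; code the sequence of these.
    König : (F : Pred (LinearOrder ∥ κ ∥) (suc 0ℓ)) →
            (∀ S → ∃[ N ] N ∈ F × code S ⊑ N) → ∃[ n ] (∀ P → Recovered F n P)
    König F cover = dne λ none → absurd λ n → ¬∀⇒∃¬ λ all → none (n , all)
      where
      absurd : ¬ (∀ n → ∃[ P ] ¬ Recovered F n P)
      absurd missed =
        let N , N∈F , f = cover diagonal
            n = _⊑_.to f (start diagonal i₀)
        in proj₂ (missed n) (N , N∈F , diagonal , (f , refl) , λ i →
             cong (λ (n , i) → proj₁ (missed n) i) (pair.strictlyInverseʳ (n , i)))
        where
        diagonal : Subset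
        diagonal x = let n , i = pair.from x in proj₁ (missed n) i

    2^κ-injection : (F : Pred (LinearOrder ∥ κ ∥) (suc 0ℓ)) →
                    (∀ S → ∃[ N ] N ∈ F × code S ⊑ N) → Injection (2^ κ) (Members (LO ∥ κ ∥) F)
    2^κ-injection F cover = record
      { to        = member
      ; cong      = λ P≗Q → Setoid.reflexive (Members (LO ∥ κ ∥) F) (cong member (extensionality P≗Q))
      ; injective = λ {P} {Q} N≈N′ i →
          let _ , _ , S , S-at , S-P = proj₂ (König F cover) P
              _ , _ , T , T-at , T-Q = proj₂ (König F cover) Q
          in trans (sym (S-P i)) (trans (CodedAt-unique N≈N′ S-at T-at _) (T-Q i))
      }
      where
      member : Subset → ∃ F
      member P = let N , N∈F , _ = proj₂ (König F cover) P in N , N∈F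

    -- Otherwise the power set of κ would inject into the one-element set {N}.
    no-universal : (N : LinearOrder ∥ κ ∥) → ¬ (∀ S → code S ⊑ N)
    no-universal N all =
      case same (λ _ → true) (λ _ → false) i₀ of λ ()
      where
      into : Injection (2^ κ) (Members (LO ∥ κ ∥) (_≡ N))
      into = 2^κ-injection (_≡ N) λ S → N , refl , all S

      same : ∀ (P Q : Subset) i → P i ≡ Q i
      same P Q = Injection.injective into {P} {Q} (Setoid.reflexive (LO ∥ κ ∥)
        (trans (proj₂ (Injection.to into P)) (sym (proj₂ (Injection.to into Q)))))

    -- Orders on κ above a given one that carry a given code

    module Extension (K₀ : Lin κ) where
      private
        module K₀ = Lin K₀

      -- The summands of L + Σ K₀ (code S), over the index order -∞ + K₀.
      Summand : Subset → K₀.Carrier ₋ → Set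
      Summand S ⊥₋    = ∥ κ ∥
      Summand S [ m ] = Code S

      indexOrder : LinearOrder (K₀.Carrier ₋)
      indexOrder = record
        { isTotalOrder = Infimum.≤₋-isTotalOrder-≡ _ (LinearOrder.isTotalOrder K₀.order)
        }

      summandOrder : LinearOrder ∥ κ ∥ → ∀ S k → LinearOrder (Summand S k)
      summandOrder L S ⊥₋    = L
      summandOrder L S [ m ] = code S

      κ↔extension : ∀ S → ∥ κ ∥ ↔ Σ (K₀.Carrier ₋) (Summand S)
      κ↔extension S = ⤖⇒↔ (cantorSchröderBernstein
        (mk↣ {to = ⊥₋ ,_} λ { refl → refl })
        (mk↣ {to = absorb.to ∘ encode} λ {p} {q} e → encode-injective p q (absorb.injective e)))
        where
        encode : Σ (K₀.Carrier ₋) (Summand S) → V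
        encode (⊥₋    , x)     = sq.to (inj₁ 0 , inj₂ x)
        encode ([ m ] , i , d) = sq.to (inj₂ (Injection.to K₀.small m) ,
          sq.to (inj₂ i , inj₁ (Injection.to (block-countable (S i)) d)))

        encode-injective : ∀ p q → encode p ≡ encode q → p ≡ q
        encode-injective (⊥₋    , x)     (⊥₋     , y)      e =
          cong (⊥₋ ,_) (inj₂-injective (,-injectiveʳ (sq.injective e)))
        encode-injective (⊥₋    , x)     ([ m ]  , _)      e = case ,-injectiveˡ (sq.injective e) of λ ()
        encode-injective ([ m ] , _)     (⊥₋     , y)      e = case ,-injectiveˡ (sq.injective e) of λ ()
        encode-injective ([ m ] , i , d) ([ m′ ] , i′ , d′) e
          with refl ← Injection.injective K₀.small (inj₂-injective (,-injectiveˡ (sq.injective e)))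
          with e′ ← sq.injective (,-injectiveʳ (sq.injective e))
          with refl ← inj₂-injective (,-injectiveˡ e′)
          with refl ← Injection.injective (block-countable (S i)) (inj₁-injective (,-injectiveʳ e′))
          = refl

      -- The order L + Σ K₀ (code S), carried over to κ.
      extend : LinearOrder ∥ κ ∥ → Subset → LinearOrder ∥ κ ∥
      extend L S = pullback (κ↔extension S) (sumOrder indexOrder (summandOrder L S))

      summand-⊑ : ∀ L S k → summandOrder L S k ⊑ extend L S
      summand-⊑ L S k = ⊑-trans (summand indexOrder (summandOrder L S) k)
                                (⊑-pullback (κ↔extension S) (sumOrder indexOrder (summandOrder L S)))

    -- Maximal elements and dominating families

    module _ {𝓛 : Pred (Lin κ) (suc 0ℓ)}
             (satisfiable : Satisfiable 𝓛) (closed : DownwardClosed 𝓛) where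

      -- The partition has a single part; 𝓛 contains the one-point order, as that
      -- embeds in every member.
      ⊑⇒⊴ : {L : LinearOrder A} {N : LinearOrder B} → A → L ⊑ N → L ⊴[ 𝓛 ] N
      ⊑⇒⊴ {L = L} {N = N} x₀ f =
          one
        , closed one K one⪯K (proj₂ satisfiable)
        , (λ _ → U)
        , record
            { nonempty = λ _ → x₀ , tt
            ; disjoint = λ _ _ _ _ _ → refl
            ; covers   = λ _ → tt , tt
            ; ordered  = λ _ _ → mk⇔ (λ lt → contradiction refl (proj₂ lt))
                                     (λ lt → contradiction refl (proj₂ (lt x₀ x₀ tt tt)))
            }
        , f.to
        , f.embeds
        , λ where
            _ _ y _ x≤y y≤z (_ , _ , refl) (_ , _ , refl) → map₂ (tt ,_) (f.convex x≤y y≤z)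
        where
        module f = _⊑_ f
        K = proj₁ satisfiable
        module K = Lin K

        one : Lin κ
        one = record
          { order    = record
            { _≤_          = λ _ _ → ⊤
            ; isTotalOrder = record
              { isPartialOrder = record
                { isPreorder = record
                  { isEquivalence = isEquivalence
                  ; reflexive     = λ _ → tt
                  ; trans         = λ _ _ → tt
                  }
                ; antisym    = λ _ _ → refl
                }
              ; total = λ _ _ → inj₁ tt
              }
            }
          ; nonempty = tt
          ; small    = mk↣ {to = λ _ → i₀} λ _ → refl
          }

        one⪯K : Lin.order one ⪯ K.order
        one⪯K = (λ _ → K.nonempty) , λ _ _ → mk⇔ (λ _ → Order.≤-refl K.order) (λ _ → tt)

      module _ {K₀ : Lin κ} (K₀∉𝓛 : ¬ (K₀ ∈ 𝓛)) where
        open Extension K₀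

        ⊴-extend : ∀ L S → L ⊴[ 𝓛 ] extend L S
        ⊴-extend L S = ⊑⇒⊴ i₀ (summand-⊑ L S ⊥₋)

        extend-⊴⇒⊑ : ∀ L S {N : LinearOrder B} → extend L S ⊴[ 𝓛 ] N → code S ⊑ N
        extend-⊴⇒⊑ L S = copies⇒⊑ closed K₀∉𝓛 (start S i₀) (λ m → summand-⊑ L S [ m ])
          λ m<m′ x y → _⊑_.mono-< (⊑-pullback (κ↔extension S) (sumOrder indexOrder (summandOrder L S)))
            (outer-< indexOrder (summandOrder L S) (Infimum.[ proj₁ m<m′ ] , proj₂ m<m′ ∘ []-injective))

        ¬maximal : ∀ L → ¬ IsMaximal (⊴-on-LO κ 𝓛) L
        ¬maximal L maximal = no-universal L λ S →
          extend-⊴⇒⊑ L S (dne λ L⋬ → maximal (extend L S , ⊴-extend L S , L⋬))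

        -- Any other order on κ would do in place of κ-order.
        dominating-injection : ∀ F → IsDominating (⊴-on-LO κ 𝓛) F →
                               Injection (2^ κ) (Members (LO ∥ κ ∥) F)
        dominating-injection F dominating = 2^κ-injection F λ S →
          map₂ (map₂ (extend-⊴⇒⊑ κ-order S)) (dominating (extend κ-order S))

        dominating-size : ∀ F → IsDominating (⊴-on-LO κ 𝓛) F → HasSize (LO ∥ κ ∥) F (2^ κ)
        dominating-size F dominating =
          cantorSchröderBernstein (dominating-injection F dominating) (LO-injection F)

        dominating-number : 𝔡[ LO ∥ κ ∥ , ⊴-on-LO κ 𝓛 ]≡ (2^ κ)
        dominating-number = (Uₚ , everything , dominating-size Uₚ everything) , dominating-injection
          where
          everything : IsDominating (⊴-on-LO κ 𝓛) Uₚ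
          everything L = L , _ , ⊑⇒⊴ i₀ (≈⇒⊑ {N = L} {L} (Setoid.refl (LO ∥ κ ∥) {L}))

theorem8p8 : Classical →
    (κ : InfiniteCardinal) (𝓛 : Pred (Lin κ) (suc 0ℓ)) →
    𝓛 ⊂ U →
    Satisfiable 𝓛 →
    DownwardClosed 𝓛 →
    Transitive (⊴-on-LO κ 𝓛) →
    (∀ L → ¬ IsMaximal (⊴-on-LO κ 𝓛) L) ×
    (∀ F → IsDominating (⊴-on-LO κ 𝓛) F → HasSize (LO ∥ κ ∥) F (2^ κ)) ×
    (𝔡[ LO ∥ κ ∥ , ⊴-on-LO κ 𝓛 ]≡ (2^ κ))
theorem8p8 cl κ 𝓛 (_ , U⊈𝓛) satisfiable closed _ =
    ¬maximal cl κ satisfiable closed K₀∉𝓛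
  , dominating-size cl κ satisfiable closed K₀∉𝓛
  , dominating-number cl κ satisfiable closed K₀∉𝓛
  where
  outside : ∃[ K₀ ] ¬ (K₀ ∈ 𝓛)
  outside = ¬∀⇒∃¬ cl λ all → U⊈𝓛 λ {K} _ → all K

  K₀∉𝓛 = proj₂ outside
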